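{- Let $\mathcal G$ be a 2-graph and let $\mathcal S(\mathcal G)$ be the syntactic bicategory, with a single fixed variable name $x$, of the type theory $\Lambda^{\mathrm b}(\mathcal G)$ (defined in the context). Let $\iota:\mathcal G\hookrightarrow\mathcal S(\mathcal G)$ be the inclusion. For any bicategory $\mathcal B$ and any 2-graph homomorphism $h:\mathcal G\to\mathcal B$ there exists a unique strict pseudofunctor $h^{\#}:\mathcal S(\mathcal G)\to\mathcal B$ such that $h^{\#}\circ\iota=h$.
   Context: **2-graphs.** A 2-graph $\mathcal G$ is a set $\mathcal G_0$ of nodes together with, for all $A,B\in\mathcal G_0$, a directed graph $\mathcal G(A;B)$, whose nodes are called edges and whose arrows are called surfaces; $\mathcal G(A;B)(c,c')$ is the set of surfaces from $c$ to $c'$. A homomorphism maps nodes, edges and surfaces compatibly. Every bicategory has an underlying 2-graph (objects, 1-cells, 2-cells), and a homomorphism $\mathcal G\to\mathcal B$ means one into this underlying 2-graph. **Pseudofunctors.** A pseudofunctor is strict if its structural 2-cells $\mathrm{Id}_{FX}\Rightarrow F(\mathrm{Id}_X)$ and $F(f)\circ F(g)\Rightarrow F(f\circ g)$ are identities. Vertical composition is written $\bullet$. **The type theory $\Lambda^{\mathrm b}(\mathcal G)$.** Types are the nodes of $\mathcal G$. Contexts are unary, $(x:A)$. Judgements are $x:A\vdash t:B$ (terms), $x:A\vdash\tau:t\Rightarrow t':B$ (rewrites), and $x:A\vdash\tau\equiv\tau':t\Rightarrow t':B$. Terms and rewrites are taken up to $\alpha$-equivalence. *Terms:* - $x:A\vdash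 x:A$; - $x:A\vdash c(x):B$ for each edge $c\in\mathcal G(A;B)$; - if $x:A\vdash t:B$ and $y:D\vdash u:A$ then $y:D\vdash t\{x\mapsto u\}:B$ (explicit substitution, binding $x$ in $t$). *Rewrites:* - $\mathrm{id}_t:t\Rightarrow t$; - $x:A\vdash\sigma(x):c(x)\Rightarrow c'(x):B$ for each surface $\sigma\in\mathcal G(A;B)(c,c')$; - $\iota_t:t\Rightarrow t\{x\mapsto x\}$; - $\varrho_u:x\{x\mapsto u\}\Rightarrow u$; - $\mathsf{assoc}_{t,v,u}:t\{y\mapsto v\}\{x\mapsto u\}\Rightarrow t\{y\mapsto v\{x\mapsto u\}\}$; - formal inverses of $\iota,\varrho,\mathsf{assoc}$; - $\tau'\bullet\tau:t\Rightarrow t''$ for $\tau:t\Rightarrow t'$, $\tau':t'\Rightarrow t''$; - $\tau\{x\mapsto\sigma\}:t\{x\mapsto u\}\Rightarrow t'\{x\mapsto u'\}$ for $\tau:t\Rightarrow t'$, $\sigma:u\Rightarrow u'$. *Equations:* $\equiv$ is the least congruence (equivalence relation compatible with all rewrite constructors) on rewrites such that (writing $t$ for $\mathrm{id}_t$ inside rewrites): - $\bullet$ is associative with units $\mathrm{id}$; - $\mathrm{id}_t\{x\mapsto \mathrm{id}_u\}\equiv\mathrm{id}_{t\{x\mapsto u\}}$; - $\tau'\{x\mapsto\sigma'\}\bullet\tau\{x\mapsto\sigma\}\equiv(\tau'\bullet\tau)\{x\mapsto\sigma'\bullet\sigma\}$; - naturality: $\varrho_{u'}\bullet x\{x\mapsto\sigma\}\equiv\sigma\bullet\varrho_u$,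 $\ \iota_{t'}\bullet\tau\equiv\tau\{x\mapsto x\}\bullet\iota_t$, $\ \mathsf{assoc}_{t',v',u'}\bullet\tau\{y\mapsto\sigma\}\{x\mapsto\mu\}\equiv\tau\{y\mapsto\sigma\{x\mapsto\mu\}\}\bullet\mathsf{assoc}_{t,v,u}$; - $t\{x\mapsto\varrho_u\}\bullet\mathsf{assoc}_{t,x,u}\bullet\iota_t\{x\mapsto u\}\equiv\mathrm{id}_{t\{x\mapsto u\}}$; - $t\{z\mapsto\mathsf{assoc}_{w,v,u}\}\bullet\mathsf{assoc}_{t,w\{y\mapsto v\},u}\bullet\mathsf{assoc}_{t,w,v}\{x\mapsto u\}\equiv\mathsf{assoc}_{t,w,v\{x\mapsto u\}}\bullet\mathsf{assoc}_{t\{z\mapsto w\},v,u}$; - the formal inverses are two-sided inverses. **The bicategory $\mathcal S(\mathcal G)$.** Fix a variable $x$. Objects are the unary contexts $(x:A)$, $A\in\mathcal G_0$. The hom-category from $(x:A)$ to $(x:B)$ has as objects $\alpha$-equivalence classes of derivable terms $x:A\vdash t:B$ and as morphisms equivalence classes, modulo $\alpha$-equivalence and $\equiv$, of derivable rewrites $x:A\vdash\tau:t\Rightarrow t':B$, composed by $\bullet$. Horizontal composition is explicit substitution, $t\circ u=t\{x\mapsto u\}$ and $\tau\circ\sigma=\tau\{x\mapsto\sigma\}$; the identity on $(x:A)$ is the term $x$. The structural isomorphisms are $\mathbf l=\varrho:\mathrm{Id}\circ u\Rightarrow u$, $\mathbf r=\iota^{ -1}:t\circ\mathrm{Id}\Rightarrow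 t$, $\mathbf a=\mathsf{assoc}$. The inclusion $\iota:\mathcal G\hookrightarrow\mathcal S(\mathcal G)$ sends $A\mapsto(x:A)$, $c\mapsto c(x)$, $\sigma\mapsto\sigma(x)$. -}

{-# OPTIONS --with-K #-}

module Defs where

open import Level using (Level; _⊔_; suc)
open import Data.Product using (Σ-syntax; _×_; _,_)
open import Relation.Binary.Core using (Rel)
open import Relation.Binary.Structures using (IsEquivalence)
open import Relation.Binary.PropositionalEquality.Core using (_≡_; refl)

private
  variable
    o e s ℓ o′ e′ s′ ℓ′ o″ e″ s″ ℓ″ : Level

------------------------------------------------------------------------
-- 2-graphs

-- In the absence of quotients, a set of surfaces is a setoid: the 2-cells of
-- the syntactic bicategory are equivalence classes, and underlying 2-graphs
-- of bicategories have to be 2-graphs.  Nodes and edges are compared with _≡_.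
-- A 2-graph with plain sets of surfaces is the case in which _≈_ is _≡_.
record TwoGraph (o e s ℓ : Level) : Set (suc (o ⊔ e ⊔ s ⊔ ℓ)) where
  infix 4 _≈_
  field
    Node          : Set o
    Edge          : Node → Node → Set e
    Surface       : ∀ {A B} → Edge A B → Edge A B → Set s
    _≈_           : ∀ {A B} {c c′ : Edge A B} → Rel (Surface c c′) ℓ
    isEquivalence : ∀ {A B} {c c′ : Edge A B} → IsEquivalence (_≈_ {c = c} {c′})

  infix 4 _≅ᴱ_ _≅ˢ_

  -- Equality of edges (resp. surfaces) whose end points are not
  -- definitionally the same: the end points are equal and, once they have
  -- been identified, so are the edges (resp. surfaces).  Axiom K is in force,
  -- so it is immaterial along which proof the end points are identified.
  data _≅ᴱ_ {A B} (c : Edge A B) : ∀ {A′ B′} → Edge A′ B′ → Set e where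
    same : c ≅ᴱ c

  data _≅ˢ_ {A B} {c c′ : Edge A B} (σ : Surface c c′) :
            ∀ {A′ B′} {d d′ : Edge A′ B′} → Surface d d′ → Set (s ⊔ ℓ) where
    same : ∀ {σ′ : Surface c c′} → σ ≈ σ′ → σ ≅ˢ σ′

record TwoGraphHom (G : TwoGraph o e s ℓ) (H : TwoGraph o′ e′ s′ ℓ′) :
                   Set (o ⊔ e ⊔ s ⊔ ℓ ⊔ o′ ⊔ e′ ⊔ s′ ⊔ ℓ′) where
  private
    module G = TwoGraph G
    module H = TwoGraph H
  field
    node         : G.Node → H.Node
    edge         : ∀ {A B} → G.Edge A B → H.Edge (node A) (node B)
    surface      : ∀ {A B} {c c′ : G.Edge A B} →
                   G.Surface c c′ → H.Surface (edge c) (edge c′)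
    surface-cong : ∀ {A B} {c c′ : G.Edge A B} {σ τ : G.Surface c c′} →
                   σ G.≈ τ → surface σ H.≈ surface τ

infixr 9 _∘ᴴ_

_∘ᴴ_ : {G : TwoGraph o e s ℓ} {H : TwoGraph o′ e′ s′ ℓ′} {K : TwoGraph o″ e″ s″ ℓ″} →
       TwoGraphHom H K → TwoGraphHom G H → TwoGraphHom G K
k ∘ᴴ h = record
  { node         = λ A → k.node (h.node A)
  ; edge         = λ c → k.edge (h.edge c)
  ; surface      = λ σ → k.surface (h.surface σ)
  ; surface-cong = λ p → k.surface-cong (h.surface-cong p)
  }
  where
  module k = TwoGraphHom k
  module h = TwoGraphHom h

infix 4 _≈ᴴ_

record _≈ᴴ_ {G : TwoGraph o e s ℓ} {H : TwoGraph o′ e′ s′ ℓ′}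
            (h k : TwoGraphHom G H) : Set (o ⊔ e ⊔ s ⊔ o′ ⊔ e′ ⊔ s′ ⊔ ℓ′) where
  private
    module G = TwoGraph G
    module H = TwoGraph H
    module h = TwoGraphHom h
    module k = TwoGraphHom k
  field
    node≈    : ∀ A → h.node A ≡ k.node A
    edge≈    : ∀ {A B} (c : G.Edge A B) → h.edge c H.≅ᴱ k.edge c
    surface≈ : ∀ {A B} {c c′ : G.Edge A B} (σ : G.Surface c c′) →
               h.surface σ H.≅ˢ k.surface σ

------------------------------------------------------------------------
-- Bicategories

record Bicategory (o e s ℓ : Level) : Set (suc (o ⊔ e ⊔ s ⊔ ℓ)) where
  infixr 9 _∘_
  infixr 8 _∗_
  infixr 7 _•_
  field
    twoGraph : TwoGraph o e s ℓ

  open TwoGraph twoGraph public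
    renaming (Node to Obj; Edge to infix 5 _⟶_; Surface to infix 5 _⇒_)

  field
    -- hom-categories
    id       : ∀ {A B} {f : A ⟶ B} → f ⇒ f
    _•_      : ∀ {A B} {f g h : A ⟶ B} → g ⇒ h → f ⇒ g → f ⇒ h
    •-cong   : ∀ {A B} {f g h : A ⟶ B} {β β′ : g ⇒ h} {α α′ : f ⇒ g} →
               β ≈ β′ → α ≈ α′ → β • α ≈ β′ • α′
    •-assoc  : ∀ {A B} {f g h k : A ⟶ B} (γ : h ⇒ k) (β : g ⇒ h) (α : f ⇒ g) →
               (γ • β) • α ≈ γ • (β • α)
    •-idˡ    : ∀ {A B} {f g : A ⟶ B} (α : f ⇒ g) → id • α ≈ α
    •-idʳ    : ∀ {A B} {f g : A ⟶ B} (α : f ⇒ g) → α • id ≈ α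

    -- identities and the composition functors
    Id       : ∀ {A} → A ⟶ A
    _∘_      : ∀ {A B C} → B ⟶ C → A ⟶ B → A ⟶ C
    _∗_      : ∀ {A B C} {f f′ : B ⟶ C} {g g′ : A ⟶ B} →
               f ⇒ f′ → g ⇒ g′ → f ∘ g ⇒ f′ ∘ g′
    ∗-cong   : ∀ {A B C} {f f′ : B ⟶ C} {g g′ : A ⟶ B} {α α′ : f ⇒ f′} {β β′ : g ⇒ g′} →
               α ≈ α′ → β ≈ β′ → α ∗ β ≈ α′ ∗ β′
    ∗-id     : ∀ {A B C} {f : B ⟶ C} {g : A ⟶ B} → id {f = f} ∗ id {f = g} ≈ id
    ∗-•      : ∀ {A B C} {f f′ f″ : B ⟶ C} {g g′ g″ : A ⟶ B}
               (α′ : f′ ⇒ f″) (α : f ⇒ f′) (β′ : g′ ⇒ g″) (β : g ⇒ g′) →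
               (α′ • α) ∗ (β′ • β) ≈ (α′ ∗ β′) • (α ∗ β)

  Invertible : ∀ {A B} {f g : A ⟶ B} → f ⇒ g → Set (s ⊔ ℓ)
  Invertible {f = f} {g} α = Σ[ α⁻¹ ∈ g ⇒ f ] (α⁻¹ • α ≈ id) × (α • α⁻¹ ≈ id)

  IsIdentity : ∀ {A B} {f g : A ⟶ B} → f ⇒ g → Set (s ⊔ ℓ)
  IsIdentity {f = f} α = α ≅ˢ id {f = f}

  field
    -- structural isomorphisms
    l            : ∀ {A B} (f : A ⟶ B) → Id ∘ f ⇒ f
    r            : ∀ {A B} (f : A ⟶ B) → f ∘ Id ⇒ f
    a            : ∀ {A B C D} (f : C ⟶ D) (g : B ⟶ C) (h : A ⟶ B) →
                   (f ∘ g) ∘ h ⇒ f ∘ (g ∘ h)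
    l-invertible : ∀ {A B} (f : A ⟶ B) → Invertible (l f)
    r-invertible : ∀ {A B} (f : A ⟶ B) → Invertible (r f)
    a-invertible : ∀ {A B C D} (f : C ⟶ D) (g : B ⟶ C) (h : A ⟶ B) →
                   Invertible (a f g h)
    l-natural    : ∀ {A B} {f f′ : A ⟶ B} (α : f ⇒ f′) → l f′ • (id ∗ α) ≈ α • l f
    r-natural    : ∀ {A B} {f f′ : A ⟶ B} (α : f ⇒ f′) → r f′ • (α ∗ id) ≈ α • r f
    a-natural    : ∀ {A B C D} {f f′ : C ⟶ D} {g g′ : B ⟶ C} {h h′ : A ⟶ B}
                   (α : f ⇒ f′) (β : g ⇒ g′) (γ : h ⇒ h′) →
                   a f′ g′ h′ • ((α ∗ β) ∗ γ) ≈ (α ∗ (β ∗ γ)) • a f g h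

    triangle     : ∀ {A B C} (f : B ⟶ C) (g : A ⟶ B) →
                   (id ∗ l g) • a f Id g ≈ r f ∗ id
    pentagon     : ∀ {A B C D E} (f : D ⟶ E) (g : C ⟶ D) (h : B ⟶ C) (k : A ⟶ B) →
                   (id ∗ a g h k) • a f (g ∘ h) k • (a f g h ∗ id)
                   ≈ a f g (h ∘ k) • a (f ∘ g) h k

------------------------------------------------------------------------
-- Pseudofunctors

record Pseudofunctor (𝓑 : Bicategory o e s ℓ) (𝓒 : Bicategory o′ e′ s′ ℓ′) :
                     Set (o ⊔ e ⊔ s ⊔ ℓ ⊔ o′ ⊔ e′ ⊔ s′ ⊔ ℓ′) where
  private
    module B = Bicategory 𝓑
    module C = Bicategory 𝓒
  open Bicategory 𝓒 using (_∘_; _∗_; _•_; _≈_; _⇒_)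
  field
    hom : TwoGraphHom B.twoGraph C.twoGraph

  open TwoGraphHom hom public
    renaming (node to F₀; edge to F₁; surface to F₂; surface-cong to F₂-cong)

  field
    F₂-id        : ∀ {X Y} {f : X B.⟶ Y} → F₂ (B.id {f = f}) ≈ C.id
    F₂-•         : ∀ {X Y} {f g h : X B.⟶ Y} (β : g B.⇒ h) (α : f B.⇒ g) →
                   F₂ (β B.• α) ≈ F₂ β • F₂ α

    ψ            : ∀ X → C.Id {F₀ X} ⇒ F₁ (B.Id {X})
    φ            : ∀ {X Y Z} (f : Y B.⟶ Z) (g : X B.⟶ Y) → F₁ f ∘ F₁ g ⇒ F₁ (f B.∘ g)
    ψ-invertible : ∀ X → C.Invertible (ψ X)
    φ-invertible : ∀ {X Y Z} (f : Y B.⟶ Z) (g : X B.⟶ Y) → C.Invertible (φ f g)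
    φ-natural    : ∀ {X Y Z} {f f′ : Y B.⟶ Z} {g g′ : X B.⟶ Y}
                   (α : f B.⇒ f′) (β : g B.⇒ g′) →
                   φ f′ g′ • (F₂ α ∗ F₂ β) ≈ F₂ (α B.∗ β) • φ f g

    F-l          : ∀ {X Y} (f : X B.⟶ Y) →
                   F₂ (B.l f) • φ B.Id f • (ψ Y ∗ C.id) ≈ C.l (F₁ f)
    F-r          : ∀ {X Y} (f : X B.⟶ Y) →
                   F₂ (B.r f) • φ f B.Id • (C.id ∗ ψ X) ≈ C.r (F₁ f)
    F-a          : ∀ {W X Y Z} (f : Y B.⟶ Z) (g : X B.⟶ Y) (h : W B.⟶ X) →
                   F₂ (B.a f g h) • φ (f B.∘ g) h • (φ f g ∗ C.id)
                   ≈ φ f (g B.∘ h) • (C.id ∗ φ g h) • C.a (F₁ f) (F₁ g) (F₁ h)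

record StrictPseudofunctor (𝓑 : Bicategory o e s ℓ) (𝓒 : Bicategory o′ e′ s′ ℓ′) :
                           Set (o ⊔ e ⊔ s ⊔ ℓ ⊔ o′ ⊔ e′ ⊔ s′ ⊔ ℓ′) where
  private
    module B = Bicategory 𝓑
    module C = Bicategory 𝓒
  field
    pseudofunctor : Pseudofunctor 𝓑 𝓒

  open Pseudofunctor pseudofunctor public

  field
    ψ-strict : ∀ X → C.IsIdentity (ψ X)
    φ-strict : ∀ {X Y Z} (f : Y B.⟶ Z) (g : X B.⟶ Y) → C.IsIdentity (φ f g)

infix 4 _≈ᴾ_ _≈ˢᴾ_

record _≈ᴾ_ {𝓑 : Bicategory o e s ℓ} {𝓒 : Bicategory o′ e′ s′ ℓ′}
            (F G : Pseudofunctor 𝓑 𝓒) : Set (o ⊔ e ⊔ s ⊔ o′ ⊔ e′ ⊔ s′ ⊔ ℓ′) where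
  private
    module B = Bicategory 𝓑
    module C = Bicategory 𝓒
    module F = Pseudofunctor F
    module G = Pseudofunctor G
  field
    hom≈ : F.hom ≈ᴴ G.hom
    ψ≈   : ∀ X → F.ψ X C.≅ˢ G.ψ X
    φ≈   : ∀ {X Y Z} (f : Y B.⟶ Z) (g : X B.⟶ Y) → F.φ f g C.≅ˢ G.φ f g

_≈ˢᴾ_ : {𝓑 : Bicategory o e s ℓ} {𝓒 : Bicategory o′ e′ s′ ℓ′} →
        Rel (StrictPseudofunctor 𝓑 𝓒) (o ⊔ e ⊔ s ⊔ o′ ⊔ e′ ⊔ s′ ⊔ ℓ′)
F ≈ˢᴾ G = StrictPseudofunctor.pseudofunctor F ≈ᴾ StrictPseudofunctor.pseudofunctor G

------------------------------------------------------------------------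
-- The type theory Λᵇ(𝒢)

module Λᵇ (𝒢 : TwoGraph o e s ℓ) where
  private
    module 𝒢 = TwoGraph 𝒢
  open TwoGraph 𝒢 using (Node; Edge; Surface)

  infixl 9 _[_] _[_]ᴿ
  infixr 7 _•_
  infix  4 _⇒_ _≈_

  -- Tm A B consists of the α-equivalence classes of derivable terms
  -- x : A ⊢ t : B.  Contexts being unary, every subterm has exactly one free
  -- variable, and t [ u ], that is t{x ↦ u}, binds the only free variable
  -- of t.  Names thus carry no information up to α-equivalence, and
  -- α-equivalence is _≡_.
  data Tm : Node → Node → Set (o ⊔ e) where
    var  : ∀ {A} → Tm A A
    con  : ∀ {A B} → Edge A B → Tm A B
    _[_] : ∀ {A B D} → Tm A B → Tm D A → Tm D B

  data _⇒_ : ∀ {A B} → Tm A B → Tm A B → Set (o ⊔ e ⊔ s) where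
    id      : ∀ {A B} (t : Tm A B) → t ⇒ t
    con     : ∀ {A B} {c c′ : Edge A B} → Surface c c′ → con c ⇒ con c′
    ι       : ∀ {A B} (t : Tm A B) → t ⇒ t [ var ]
    ι⁻¹     : ∀ {A B} (t : Tm A B) → t [ var ] ⇒ t
    ϱ       : ∀ {A B} (u : Tm A B) → var [ u ] ⇒ u
    ϱ⁻¹     : ∀ {A B} (u : Tm A B) → u ⇒ var [ u ]
    assoc   : ∀ {A B C D} (t : Tm C D) (v : Tm B C) (u : Tm A B) →
              t [ v ] [ u ] ⇒ t [ v [ u ] ]
    assoc⁻¹ : ∀ {A B C D} (t : Tm C D) (v : Tm B C) (u : Tm A B) →
              t [ v [ u ] ] ⇒ t [ v ] [ u ]
    _•_     : ∀ {A B} {t t′ t″ : Tm A B} → t′ ⇒ t″ → t ⇒ t′ → t ⇒ t″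
    _[_]ᴿ   : ∀ {A B D} {t t′ : Tm A B} {u u′ : Tm D A} →
              t ⇒ t′ → u ⇒ u′ → t [ u ] ⇒ t′ [ u′ ]

  data _≈_ : ∀ {A B} {t t′ : Tm A B} → Rel (t ⇒ t′) (o ⊔ e ⊔ s ⊔ ℓ) where
    -- congruence; con-cong says that the rewrites σ(x) are indexed by the
    -- set of surfaces, that is by surfaces up to equality in 𝒢
    ≈-refl    : ∀ {A B} {t t′ : Tm A B} {τ : t ⇒ t′} → τ ≈ τ
    ≈-sym     : ∀ {A B} {t t′ : Tm A B} {τ τ′ : t ⇒ t′} → τ ≈ τ′ → τ′ ≈ τ
    ≈-trans   : ∀ {A B} {t t′ : Tm A B} {τ τ′ τ″ : t ⇒ t′} → τ ≈ τ′ → τ′ ≈ τ″ → τ ≈ τ″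
    con-cong  : ∀ {A B} {c c′ : Edge A B} {σ σ′ : Surface c c′} →
                σ 𝒢.≈ σ′ → con σ ≈ con σ′
    •-cong    : ∀ {A B} {t t′ t″ : Tm A B} {τ′ σ′ : t′ ⇒ t″} {τ σ : t ⇒ t′} →
                τ′ ≈ σ′ → τ ≈ σ → τ′ • τ ≈ σ′ • σ
    []-cong   : ∀ {A B D} {t t′ : Tm A B} {u u′ : Tm D A} {τ τ′ : t ⇒ t′} {σ σ′ : u ⇒ u′} →
                τ ≈ τ′ → σ ≈ σ′ → τ [ σ ]ᴿ ≈ τ′ [ σ′ ]ᴿ

    •-assoc   : ∀ {A B} {t t′ t″ t‴ : Tm A B} (τ″ : t″ ⇒ t‴) (τ′ : t′ ⇒ t″) (τ : t ⇒ t′) →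
                (τ″ • τ′) • τ ≈ τ″ • (τ′ • τ)
    •-idˡ     : ∀ {A B} {t t′ : Tm A B} (τ : t ⇒ t′) → id t′ • τ ≈ τ
    •-idʳ     : ∀ {A B} {t t′ : Tm A B} (τ : t ⇒ t′) → τ • id t ≈ τ

    []-id     : ∀ {A B D} (t : Tm A B) (u : Tm D A) → id t [ id u ]ᴿ ≈ id (t [ u ])
    []-•      : ∀ {A B D} {t t′ t″ : Tm A B} {u u′ u″ : Tm D A}
                (τ′ : t′ ⇒ t″) (τ : t ⇒ t′) (σ′ : u′ ⇒ u″) (σ : u ⇒ u′) →
                τ′ [ σ′ ]ᴿ • τ [ σ ]ᴿ ≈ (τ′ • τ) [ σ′ • σ ]ᴿ

    ϱ-nat     : ∀ {A B} {u u′ : Tm A B} (σ : u ⇒ u′) → ϱ u′ • id var [ σ ]ᴿ ≈ σ • ϱ u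
    ι-nat     : ∀ {A B} {t t′ : Tm A B} (τ : t ⇒ t′) → ι t′ • τ ≈ τ [ id var ]ᴿ • ι t
    assoc-nat : ∀ {A B C D} {t t′ : Tm C D} {v v′ : Tm B C} {u u′ : Tm A B}
                (τ : t ⇒ t′) (σ : v ⇒ v′) (μ : u ⇒ u′) →
                assoc t′ v′ u′ • τ [ σ ]ᴿ [ μ ]ᴿ ≈ τ [ σ [ μ ]ᴿ ]ᴿ • assoc t v u

    triangle  : ∀ {A B D} (t : Tm A B) (u : Tm D A) →
                id t [ ϱ u ]ᴿ • assoc t var u • ι t [ id u ]ᴿ ≈ id (t [ u ])
    pentagon  : ∀ {A B C D E} (t : Tm D E) (w : Tm C D) (v : Tm B C) (u : Tm A B) →
                id t [ assoc w v u ]ᴿ • assoc t (w [ v ]) u • assoc t w v [ id u ]ᴿ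
                ≈ assoc t w (v [ u ]) • assoc (t [ w ]) v u

    ι-invˡ     : ∀ {A B} (t : Tm A B) → ι⁻¹ t • ι t ≈ id t
    ι-invʳ     : ∀ {A B} (t : Tm A B) → ι t • ι⁻¹ t ≈ id (t [ var ])
    ϱ-invˡ     : ∀ {A B} (u : Tm A B) → ϱ⁻¹ u • ϱ u ≈ id (var [ u ])
    ϱ-invʳ     : ∀ {A B} (u : Tm A B) → ϱ u • ϱ⁻¹ u ≈ id u
    assoc-invˡ : ∀ {A B C D} (t : Tm C D) (v : Tm B C) (u : Tm A B) →
                 assoc⁻¹ t v u • assoc t v u ≈ id (t [ v ] [ u ])
    assoc-invʳ : ∀ {A B C D} (t : Tm C D) (v : Tm B C) (u : Tm A B) →
                 assoc t v u • assoc⁻¹ t v u ≈ id (t [ v [ u ] ])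

  private
    infixr 2 _⟩_
    _⟩_ : ∀ {A B} {t t′ : Tm A B} {τ τ′ τ″ : t ⇒ t′} → τ ≈ τ′ → τ′ ≈ τ″ → τ ≈ τ″
    _⟩_ = ≈-trans

    ι⁻¹-nat : ∀ {A B} {t t′ : Tm A B} (τ : t ⇒ t′) →
              ι⁻¹ t′ • τ [ id var ]ᴿ ≈ τ • ι⁻¹ t
    ι⁻¹-nat {t = t} {t′} τ =
        ≈-sym (•-idʳ _)
      ⟩ •-cong ≈-refl (≈-sym (ι-invʳ t))
      ⟩ ≈-sym (•-assoc _ _ _)
      ⟩ •-cong (•-assoc _ _ _
               ⟩ •-cong ≈-refl (≈-sym (ι-nat τ))
               ⟩ ≈-sym (•-assoc _ _ _)
               ⟩ •-cong (ι-invˡ t′) ≈-refl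
               ⟩ •-idˡ τ)
               ≈-refl

    ι⁻¹-triangle : ∀ {A B D} (t : Tm A B) (u : Tm D A) →
                   id t [ ϱ u ]ᴿ • assoc t var u ≈ ι⁻¹ t [ id u ]ᴿ
    ι⁻¹-triangle t u =
        ≈-sym (•-idʳ _)
      ⟩ •-cong ≈-refl (≈-sym (  []-• _ _ _ _
                              ⟩ []-cong (ι-invʳ t) (•-idˡ _)
                              ⟩ []-id _ _))
      ⟩ ≈-sym (•-assoc _ _ _)
      ⟩ •-cong (•-assoc _ _ _ ⟩ triangle t u) ≈-refl
      ⟩ •-idˡ _

  syntacticTwoGraph : TwoGraph o (o ⊔ e) (o ⊔ e ⊔ s) (o ⊔ e ⊔ s ⊔ ℓ)
  syntacticTwoGraph = record
    { Node          = Node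
    ; Edge          = Tm
    ; Surface       = _⇒_
    ; _≈_           = _≈_
    ; isEquivalence = record { refl = ≈-refl ; sym = ≈-sym ; trans = ≈-trans }
    }

  syntacticBicategory : Bicategory o (o ⊔ e) (o ⊔ e ⊔ s) (o ⊔ e ⊔ s ⊔ ℓ)
  syntacticBicategory = record
    { twoGraph     = syntacticTwoGraph
    ; id           = id _
    ; _•_          = _•_
    ; •-cong       = •-cong
    ; •-assoc      = •-assoc
    ; •-idˡ        = •-idˡ
    ; •-idʳ        = •-idʳ
    ; Id           = var
    ; _∘_          = _[_]
    ; _∗_          = _[_]ᴿ
    ; ∗-cong       = []-cong
    ; ∗-id         = []-id _ _
    ; ∗-•          = λ α′ α β′ β → ≈-sym ([]-• α′ α β′ β)
    ; l            = ϱ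
    ; r            = ι⁻¹
    ; a            = assoc
    ; l-invertible = λ u → ϱ⁻¹ u , ϱ-invˡ u , ϱ-invʳ u
    ; r-invertible = λ t → ι t , ι-invʳ t , ι-invˡ t
    ; a-invertible = λ t v u → assoc⁻¹ t v u , assoc-invˡ t v u , assoc-invʳ t v u
    ; l-natural    = ϱ-nat
    ; r-natural    = ι⁻¹-nat
    ; a-natural    = assoc-nat
    ; triangle     = ι⁻¹-triangle
    ; pentagon     = pentagon
    }

  inclusion : TwoGraphHom 𝒢 syntacticTwoGraph
  inclusion = record
    { node         = λ A → A
    ; edge         = con
    ; surface      = con
    ; surface-cong = con-cong
    }

open Λᵇ public using () renaming (syntacticBicategory to 𝓢; inclusion to ι)

{-# OPTIONS --safe #-}
{-# OPTIONS --with-K #-}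

-- Existence is by recursion on terms and rewrites: each defining equation of
-- ≡ is a bicategory law, except that ι is interpreted by r⁻¹, so that its laws
-- are those of r transported along the inverse.  For uniqueness, a strict
-- pseudofunctor G agrees with the interpretation on terms because ψ and φ
-- being identities forces G to preserve Id and ∘; the coherence laws of G then
-- determine it on ϱ, ι⁻¹, assoc and horizontal composites, and on the formal
-- inverses because inverses are unique.  As G and h agree on nodes only up to
-- _≡_, all comparisons are made with the heterogeneous relations _≅ᴱ_ and _≅ˢ_.
module Submission where

open import Level using (Level)
open import Data.Product using (∃!; _,_; proj₁; proj₂)
open import Relation.Binary.Bundles using (Setoid)
open import Relation.Binary.PropositionalEquality.Core using (_≡_; refl; sym)
open import Relation.Binary.Structures using (IsEquivalence)
import Relation.Binary.Reasoning.Setoid as SetoidReasoning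
open import Defs

private
  variable
    o e s ℓ o′ e′ s′ ℓ′ : Level

-- Heterogeneous equality of edges and surfaces.

module TwoGraphProperties (G : TwoGraph o e s ℓ) where
  open TwoGraph G
  private
    module E {A B} {c c′ : Edge A B} = IsEquivalence (isEquivalence {c = c} {c′})

  ≅ᴱ-sym : ∀ {A B A′ B′} {c : Edge A B} {d : Edge A′ B′} → c ≅ᴱ d → d ≅ᴱ c
  ≅ᴱ-sym same = same

  ≅ᴱ-trans : ∀ {A B A′ B′ A″ B″} {c : Edge A B} {d : Edge A′ B′} {f : Edge A″ B″} →
             c ≅ᴱ d → d ≅ᴱ f → c ≅ᴱ f
  ≅ᴱ-trans same q = q

  module _ {A B A′ B′} {c c′ : Edge A B} {d d′ : Edge A′ B′}
           {σ : Surface c c′} {τ : Surface d d′} where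

    ≅ˢ-sym : σ ≅ˢ τ → τ ≅ˢ σ
    ≅ˢ-sym (same p) = same (E.sym p)

    ≅ˢ-trans : ∀ {A″ B″} {f f′ : Edge A″ B″} {υ : Surface f f′} →
               σ ≅ˢ τ → τ ≅ˢ υ → σ ≅ˢ υ
    ≅ˢ-trans (same p) (same q) = same (E.trans p q)

-- Inverses, heterogeneous congruences and identity 2-cells in a bicategory.

module BicategoryProperties (𝓑 : Bicategory o e s ℓ) where
  open Bicategory 𝓑
  open TwoGraphProperties twoGraph public

  homSetoid : ∀ {A B} (f g : A ⟶ B) → Setoid s ℓ
  homSetoid f g = record { Carrier = f ⇒ g ; _≈_ = _≈_ ; isEquivalence = isEquivalence }

  module ≈ {A B} {f g : A ⟶ B} = Setoid (homSetoid f g)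
  module ≈-Reasoning {A B} {f g : A ⟶ B} = SetoidReasoning (homSetoid f g)

  infix 10 _⁻¹
  _⁻¹ : ∀ {A B} {f g : A ⟶ B} {α : f ⇒ g} → Invertible α → g ⇒ f
  _⁻¹ = proj₁

  module _ {A B} {f g : A ⟶ B} {α : f ⇒ g} (i : Invertible α) where

    ⁻¹-invˡ : i ⁻¹ • α ≈ id
    ⁻¹-invˡ = proj₁ (proj₂ i)

    ⁻¹-invʳ : α • i ⁻¹ ≈ id
    ⁻¹-invʳ = proj₂ (proj₂ i)

  id-invertible : ∀ {A B} {f : A ⟶ B} → Invertible (id {f = f})
  id-invertible = id , •-idˡ id , •-idˡ id

  -- Inserting `α • i ⁻¹` on the right of `δ` lets the square apply, after which `i′ ⁻¹` cancels
  -- `α′`. This turns naturality of `r` into naturality of its inverse and, with `γ` and `δ`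
  -- identities, gives uniqueness of inverses.
  conjugate-⁻¹ : ∀ {A B} {f g f′ g′ : A ⟶ B} {α : f ⇒ g} {α′ : f′ ⇒ g′}
                 (i : Invertible α) (i′ : Invertible α′) {γ : f ⇒ f′} {δ : g ⇒ g′} →
                 α′ • γ ≈ δ • α → i′ ⁻¹ • δ ≈ γ • i ⁻¹
  conjugate-⁻¹ {α = α} {α′} i i′ {γ} {δ} sq = begin
    i′ ⁻¹ • δ                   ≈⟨ •-cong ≈.refl (•-idʳ δ) ⟨
    i′ ⁻¹ • (δ • id)            ≈⟨ •-cong ≈.refl (•-cong ≈.refl (⁻¹-invʳ i)) ⟨
    i′ ⁻¹ • (δ • (α • i ⁻¹))    ≈⟨ •-cong ≈.refl (•-assoc δ α (i ⁻¹)) ⟨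
    i′ ⁻¹ • ((δ • α) • i ⁻¹)    ≈⟨ •-cong ≈.refl (•-cong sq ≈.refl) ⟨
    i′ ⁻¹ • ((α′ • γ) • i ⁻¹)   ≈⟨ •-cong ≈.refl (•-assoc α′ γ (i ⁻¹)) ⟩
    i′ ⁻¹ • (α′ • (γ • i ⁻¹))   ≈⟨ •-assoc (i′ ⁻¹) α′ (γ • i ⁻¹) ⟨
    (i′ ⁻¹ • α′) • (γ • i ⁻¹)   ≈⟨ •-cong (⁻¹-invˡ i′) ≈.refl ⟩
    id • (γ • i ⁻¹)             ≈⟨ •-idˡ (γ • i ⁻¹) ⟩
    γ • i ⁻¹                    ∎
    where open ≈-Reasoning

  ⁻¹-cong : ∀ {A B} {f g : A ⟶ B} {α β : f ⇒ g} (i : Invertible α) (j : Invertible β) →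
            α ≈ β → i ⁻¹ ≈ j ⁻¹
  ⁻¹-cong {α = α} {β} i j p = begin
    i ⁻¹        ≈⟨ •-idʳ (i ⁻¹) ⟨
    i ⁻¹ • id   ≈⟨ conjugate-⁻¹ j i (≈.trans (•-idʳ α) (≈.trans p (≈.sym (•-idˡ β)))) ⟩
    id • j ⁻¹   ≈⟨ •-idˡ (j ⁻¹) ⟩
    j ⁻¹        ∎
    where open ≈-Reasoning

  -- The type theory states its triangle law with `ι`, which is read as the inverse of `r`;
  -- whiskering that inverse cancels the right-hand side of `triangle`.
  triangle-⁻¹ : ∀ {A B C} (f : B ⟶ C) (g : A ⟶ B) →
                (id ∗ l g) • a f Id g • (r-invertible f ⁻¹ ∗ id) ≈ id
  triangle-⁻¹ f g = begin
    (id ∗ l g) • a f Id g • (r⁻¹ ∗ id)     ≈⟨ •-assoc _ _ _ ⟨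
    ((id ∗ l g) • a f Id g) • (r⁻¹ ∗ id)   ≈⟨ •-cong (triangle f g) ≈.refl ⟩
    (r f ∗ id) • (r⁻¹ ∗ id)                ≈⟨ ∗-• (r f) r⁻¹ id id ⟨
    (r f • r⁻¹) ∗ (id • id)                ≈⟨ ∗-cong (⁻¹-invʳ (r-invertible f)) (•-idˡ id) ⟩
    id ∗ id                                ≈⟨ ∗-id ⟩
    id                                     ∎
    where
    open ≈-Reasoning
    r⁻¹ = r-invertible f ⁻¹

  -- Heterogeneous congruences

  Id-≅ : ∀ {A A′} → A ≡ A′ → Id {A} ≅ᴱ Id {A′}
  Id-≅ refl = same

  -- The second match identifies the middle object, already shared after the first, with itself;
  -- this uses axiom K.
  ∘-≅ : ∀ {A B C A′ B′ C′} {f : B ⟶ C} {g : A ⟶ B} {f′ : B′ ⟶ C′} {g′ : A′ ⟶ B′} →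
        f ≅ᴱ f′ → g ≅ᴱ g′ → f ∘ g ≅ᴱ f′ ∘ g′
  ∘-≅ same same = same

  id-≅ : ∀ {A B A′ B′} {f : A ⟶ B} {f′ : A′ ⟶ B′} → f ≅ᴱ f′ → id {f = f} ≅ˢ id {f = f′}
  id-≅ same = same ≈.refl

  l-≅ : ∀ {A B A′ B′} {f : A ⟶ B} {f′ : A′ ⟶ B′} → f ≅ᴱ f′ → l f ≅ˢ l f′
  l-≅ same = same ≈.refl

  r-≅ : ∀ {A B A′ B′} {f : A ⟶ B} {f′ : A′ ⟶ B′} → f ≅ᴱ f′ → r f ≅ˢ r f′
  r-≅ same = same ≈.refl

  a-≅ : ∀ {A B C D A′ B′ C′ D′} {f : C ⟶ D} {g : B ⟶ C} {h : A ⟶ B}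
        {f′ : C′ ⟶ D′} {g′ : B′ ⟶ C′} {h′ : A′ ⟶ B′} →
        f ≅ᴱ f′ → g ≅ᴱ g′ → h ≅ᴱ h′ → a f g h ≅ˢ a f′ g′ h′
  a-≅ same same same = same ≈.refl

  •-≅ : ∀ {A B A′ B′} {f g h : A ⟶ B} {f′ g′ h′ : A′ ⟶ B′}
        {β : g ⇒ h} {α : f ⇒ g} {β′ : g′ ⇒ h′} {α′ : f′ ⇒ g′} →
        β ≅ˢ β′ → α ≅ˢ α′ → β • α ≅ˢ β′ • α′
  •-≅ (same p) (same q) = same (•-cong p q)

  ∗-≅ : ∀ {A B C A′ B′ C′} {f g : B ⟶ C} {h k : A ⟶ B} {f′ g′ : B′ ⟶ C′} {h′ k′ : A′ ⟶ B′}
        {α : f ⇒ g} {β : h ⇒ k} {α′ : f′ ⇒ g′} {β′ : h′ ⇒ k′} →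
        α ≅ˢ α′ → β ≅ˢ β′ → α ∗ β ≅ˢ α′ ∗ β′
  ∗-≅ (same p) (same q) = same (∗-cong p q)

  ⁻¹-≅ : ∀ {A B A′ B′} {f g : A ⟶ B} {f′ g′ : A′ ⟶ B′} {α : f ⇒ g} {α′ : f′ ⇒ g′}
         (i : Invertible α) (i′ : Invertible α′) → α ≅ˢ α′ → i ⁻¹ ≅ˢ i′ ⁻¹
  ⁻¹-≅ i i′ (same p) = same (⁻¹-cong i i′ p)

  -- Identities up to _≅ˢ_

  -- `_≅ˢ_` carries the equality of the end points, so strictness, a condition on 2-cells, yields
  -- equations between 1-cells.
  IsIdentity⇒≅ᴱ : ∀ {A B} {f g : A ⟶ B} {α : f ⇒ g} → IsIdentity α → f ≅ᴱ g
  IsIdentity⇒≅ᴱ (same _) = same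

  •-identity : ∀ {A B} {f g h : A ⟶ B} {β : g ⇒ h} {α : f ⇒ g} →
               IsIdentity β → IsIdentity α → IsIdentity (β • α)
  •-identity (same p) (same q) = same (≈.trans (•-cong p q) (•-idˡ id))

  ∗-identity : ∀ {A B C} {f g : B ⟶ C} {h k : A ⟶ B} {α : f ⇒ g} {β : h ⇒ k} →
               IsIdentity α → IsIdentity β → IsIdentity (α ∗ β)
  ∗-identity (same p) (same q) = same (≈.trans (∗-cong p q) ∗-id)

  id-identity : ∀ {A B} {f : A ⟶ B} → IsIdentity (id {f = f})
  id-identity = same ≈.refl

  •-identityˡ : ∀ {A B} {f g h : A ⟶ B} {β : g ⇒ h} (α : f ⇒ g) →
                IsIdentity β → β • α ≅ˢ α
  •-identityˡ α (same p) = same (≈.trans (•-cong p ≈.refl) (•-idˡ α))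

  •-identityʳ : ∀ {A B} {f g h : A ⟶ B} (β : g ⇒ h) {α : f ⇒ g} →
                IsIdentity α → β • α ≅ˢ β
  •-identityʳ β (same p) = same (≈.trans (•-cong ≈.refl p) (•-idʳ β))

-- Preservation of structure by pseudofunctors and by strict ones.

module PseudofunctorProperties {𝓑 : Bicategory o e s ℓ} {𝓒 : Bicategory o′ e′ s′ ℓ′}
                               (F : Pseudofunctor 𝓑 𝓒) where
  private
    module B = Bicategory 𝓑
    module C = Bicategory 𝓒
  open Pseudofunctor F
  open BicategoryProperties 𝓒

  -- The chosen inverse is by definition the image of the given one, so inverting the image of `ϱ`,
  -- `ι⁻¹` or `assoc` yields the image of the formal inverse itself.
  F₂-invertible : ∀ {X Y} {f g : X B.⟶ Y} {α : f B.⇒ g} →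
                  B.Invertible α → C.Invertible (F₂ α)
  F₂-invertible (α⁻¹ , invˡ , invʳ) =
      F₂ α⁻¹
    , ≈.trans (≈.sym (F₂-• _ _)) (≈.trans (F₂-cong invˡ) F₂-id)
    , ≈.trans (≈.sym (F₂-• _ _)) (≈.trans (F₂-cong invʳ) F₂-id)

module StrictPseudofunctorProperties {𝓑 : Bicategory o e s ℓ} {𝓒 : Bicategory o′ e′ s′ ℓ′}
                                     (F : StrictPseudofunctor 𝓑 𝓒) where
  private
    module B = Bicategory 𝓑
  open Bicategory 𝓒
  open StrictPseudofunctor F
  open BicategoryProperties 𝓒

  F₁-Id : ∀ X → Id {F₀ X} ≅ᴱ F₁ (B.Id {X})
  F₁-Id X = IsIdentity⇒≅ᴱ (ψ-strict X)

  F₁-∘ : ∀ {X Y Z} (f : Y B.⟶ Z) (g : X B.⟶ Y) → F₁ f ∘ F₁ g ≅ᴱ F₁ (f B.∘ g)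
  F₁-∘ f g = IsIdentity⇒≅ᴱ (φ-strict f g)

  -- Both instances of `φ` in `φ-natural` are identities and drop out, leaving the two horizontal
  -- composites.
  F₂-∗ : ∀ {X Y Z} {f f′ : Y B.⟶ Z} {g g′ : X B.⟶ Y} (α : f B.⇒ f′) (β : g B.⇒ g′) →
         F₂ α ∗ F₂ β ≅ˢ F₂ (α B.∗ β)
  F₂-∗ α β =
    ≅ˢ-trans (≅ˢ-sym (•-identityˡ _ (φ-strict _ _)))
   (≅ˢ-trans (same (φ-natural α β)) (•-identityʳ _ (φ-strict _ _)))

  -- In the coherence law `F-l`, everything composed with `F₂ (B.l f)` is built from `φ`, `ψ` and
  -- `id`, hence is an identity.
  F₂-l : ∀ {X Y} (f : X B.⟶ Y) → l (F₁ f) ≅ˢ F₂ (B.l f)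
  F₂-l f =
    ≅ˢ-trans (same (≈.sym (F-l f)))
             (•-identityʳ _ (•-identity (φ-strict _ _) (∗-identity (ψ-strict _) id-identity)))

  F₂-r : ∀ {X Y} (f : X B.⟶ Y) → r (F₁ f) ≅ˢ F₂ (B.r f)
  F₂-r f =
    ≅ˢ-trans (same (≈.sym (F-r f)))
             (•-identityʳ _ (•-identity (φ-strict _ _) (∗-identity id-identity (ψ-strict _))))

  F₂-a : ∀ {W X Y Z} (f : Y B.⟶ Z) (g : X B.⟶ Y) (h : W B.⟶ X) →
         a (F₁ f) (F₁ g) (F₁ h) ≅ˢ F₂ (B.a f g h)
  F₂-a f g h =
    ≅ˢ-trans (≅ˢ-sym (≅ˢ-trans (•-identityˡ _ (φ-strict _ _))
                               (•-identityˡ _ (∗-identity id-identity (φ-strict _ _)))))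
   (≅ˢ-trans (same (≈.sym (F-a f g h)))
             (•-identityʳ _ (•-identity (φ-strict _ _) (∗-identity (φ-strict _ _) id-identity))))

-- Interpretation of terms and rewrites, its soundness, and existence.

module Interpretation (𝒢 : TwoGraph o e s ℓ) (𝓑 : Bicategory o′ e′ s′ ℓ′)
                      (h : TwoGraphHom 𝒢 (Bicategory.twoGraph 𝓑)) where
  open Λᵇ 𝒢 using (Tm; var; con; _[_]; _[_]ᴿ)
  private
    module 𝒢 = TwoGraph 𝒢
    module T = Λᵇ 𝒢
    module S = Bicategory (𝓢 𝒢)
    module h = TwoGraphHom h
  open Bicategory 𝓑
  open BicategoryProperties 𝓑

  ⟦_⟧ : ∀ {A B} → Tm A B → h.node A ⟶ h.node B
  ⟦ var ⟧     = Id
  ⟦ con c ⟧   = h.edge c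
  ⟦ t [ u ] ⟧ = ⟦ t ⟧ ∘ ⟦ u ⟧

  ⟦_⟧ᴿ : ∀ {A B} {t t′ : Tm A B} → t T.⇒ t′ → ⟦ t ⟧ ⇒ ⟦ t′ ⟧
  ⟦ T.id t ⟧ᴿ          = id
  ⟦ con σ ⟧ᴿ           = h.surface σ
  ⟦ T.ι t ⟧ᴿ           = r-invertible ⟦ t ⟧ ⁻¹
  ⟦ T.ι⁻¹ t ⟧ᴿ         = r ⟦ t ⟧
  ⟦ T.ϱ u ⟧ᴿ           = l ⟦ u ⟧
  ⟦ T.ϱ⁻¹ u ⟧ᴿ         = l-invertible ⟦ u ⟧ ⁻¹
  ⟦ T.assoc t v u ⟧ᴿ   = a ⟦ t ⟧ ⟦ v ⟧ ⟦ u ⟧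
  ⟦ T.assoc⁻¹ t v u ⟧ᴿ = a-invertible ⟦ t ⟧ ⟦ v ⟧ ⟦ u ⟧ ⁻¹
  ⟦ τ′ T.• τ ⟧ᴿ        = ⟦ τ′ ⟧ᴿ • ⟦ τ ⟧ᴿ
  ⟦ τ [ σ ]ᴿ ⟧ᴿ        = ⟦ τ ⟧ᴿ ∗ ⟦ σ ⟧ᴿ

  sound : ∀ {A B} {t t′ : Tm A B} {τ τ′ : t T.⇒ t′} → τ T.≈ τ′ → ⟦ τ ⟧ᴿ ≈ ⟦ τ′ ⟧ᴿ
  sound T.≈-refl             = ≈.refl
  sound (T.≈-sym p)          = ≈.sym (sound p)
  sound (T.≈-trans p q)      = ≈.trans (sound p) (sound q)
  sound (T.con-cong p)       = h.surface-cong p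
  sound (T.•-cong p q)       = •-cong (sound p) (sound q)
  sound (T.[]-cong p q)      = ∗-cong (sound p) (sound q)
  sound (T.•-assoc _ _ _)    = •-assoc _ _ _
  sound (T.•-idˡ _)          = •-idˡ _
  sound (T.•-idʳ _)          = •-idʳ _
  sound (T.[]-id _ _)        = ∗-id
  sound (T.[]-• _ _ _ _)     = ≈.sym (∗-• _ _ _ _)
  sound (T.ϱ-nat _)          = l-natural _
  -- The naturality square of `r` with its `r` sides inverted.
  sound (T.ι-nat _)          = conjugate-⁻¹ (r-invertible _) (r-invertible _) (r-natural _)
  sound (T.assoc-nat _ _ _)  = a-natural _ _ _
  sound (T.triangle _ _)     = triangle-⁻¹ _ _
  sound (T.pentagon _ _ _ _) = pentagon _ _ _ _
  -- Left and right trade places because `ι⁻¹` is read as `r` and `ι` as its inverse.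
  sound (T.ι-invˡ _)         = ⁻¹-invʳ (r-invertible _)
  sound (T.ι-invʳ _)         = ⁻¹-invˡ (r-invertible _)
  sound (T.ϱ-invˡ _)         = ⁻¹-invˡ (l-invertible _)
  sound (T.ϱ-invʳ _)         = ⁻¹-invʳ (l-invertible _)
  sound (T.assoc-invˡ _ _ _) = ⁻¹-invˡ (a-invertible _ _ _)
  sound (T.assoc-invʳ _ _ _) = ⁻¹-invʳ (a-invertible _ _ _)

  private
    id•id∗id≈id : ∀ {A B C} {f : B ⟶ C} {g : A ⟶ B} → id • (id {f = f} ∗ id {f = g}) ≈ id
    id•id∗id≈id = ≈.trans (•-idˡ _) ∗-id

    •-unit : ∀ {A B} {f g : A ⟶ B} {α : f ⇒ g} {β : f ⇒ f} → β ≈ id → α • β ≈ α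
    •-unit p = ≈.trans (•-cong ≈.refl p) (•-idʳ _)

  ⟦⟧-strictPseudofunctor : StrictPseudofunctor (𝓢 𝒢) 𝓑
  ⟦⟧-strictPseudofunctor = record
    { pseudofunctor = record
      { hom = record
        { node         = h.node
        ; edge         = ⟦_⟧
        ; surface      = ⟦_⟧ᴿ
        ; surface-cong = sound
        }
      ; F₂-id        = ≈.refl
      ; F₂-•         = λ _ _ → ≈.refl
      -- Identities are well typed here because `⟦_⟧` sends `var` to `Id` and substitution to `_∘_`
      -- by definition.
      ; ψ            = λ _ → id
      ; φ            = λ _ _ → id
      ; ψ-invertible = λ _ → id-invertible
      ; φ-invertible = λ _ _ → id-invertible
      ; φ-natural    = λ _ _ → ≈.trans (•-idˡ _) (≈.sym (•-idʳ _))
      ; F-l          = λ _ → •-unit id•id∗id≈id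
      ; F-r          = λ _ → •-unit id•id∗id≈id
      ; F-a          = λ _ _ _ →
          ≈.trans (•-unit id•id∗id≈id)
         (≈.sym (≈.trans (•-idˡ _) (≈.trans (•-cong ∗-id ≈.refl) (•-idˡ _))))
      }
    ; ψ-strict = λ _ → id-identity
    ; φ-strict = λ _ _ → id-identity
    }

  ⟦⟧-extends : StrictPseudofunctor.hom ⟦⟧-strictPseudofunctor ∘ᴴ ι 𝒢 ≈ᴴ h
  ⟦⟧-extends = record
    { node≈    = λ _ → refl
    ; edge≈    = λ _ → same
    ; surface≈ = λ _ → same ≈.refl
    }

  -- Uniqueness of the extension.

  module Uniqueness (G : StrictPseudofunctor (𝓢 𝒢) 𝓑)
                    (extends : StrictPseudofunctor.hom G ∘ᴴ ι 𝒢 ≈ᴴ h) where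
    private
      module G = StrictPseudofunctor G
    open _≈ᴴ_ extends
    open PseudofunctorProperties G.pseudofunctor
    open StrictPseudofunctorProperties G

    -- Terms come first: the structural 2-cells are indexed by 1-cells, so they can be compared only
    -- once those agree.
    ⟦⟧-unique : ∀ {A B} (t : Tm A B) → ⟦ t ⟧ ≅ᴱ G.F₁ t
    ⟦⟧-unique var       = ≅ᴱ-trans (Id-≅ (sym (node≈ _))) (F₁-Id _)
    ⟦⟧-unique (con c)   = ≅ᴱ-sym (edge≈ c)
    ⟦⟧-unique (t [ u ]) = ≅ᴱ-trans (∘-≅ (⟦⟧-unique t) (⟦⟧-unique u)) (F₁-∘ t u)

    -- Kept separate, like the next two, because it settles both the structural rewrite and, through
    -- `⁻¹-≅`, its formal inverse.
    ϱ-unique : ∀ {A B} (u : Tm A B) → l ⟦ u ⟧ ≅ˢ G.F₂ (T.ϱ u)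
    ϱ-unique u = ≅ˢ-trans (l-≅ (⟦⟧-unique u)) (F₂-l u)

    ι⁻¹-unique : ∀ {A B} (t : Tm A B) → r ⟦ t ⟧ ≅ˢ G.F₂ (T.ι⁻¹ t)
    ι⁻¹-unique t = ≅ˢ-trans (r-≅ (⟦⟧-unique t)) (F₂-r t)

    assoc-unique : ∀ {A B C D} (t : Tm C D) (v : Tm B C) (u : Tm A B) →
                   a ⟦ t ⟧ ⟦ v ⟧ ⟦ u ⟧ ≅ˢ G.F₂ (T.assoc t v u)
    assoc-unique t v u =
      ≅ˢ-trans (a-≅ (⟦⟧-unique t) (⟦⟧-unique v) (⟦⟧-unique u)) (F₂-a t v u)

    ⟦⟧ᴿ-unique : ∀ {A B} {t t′ : Tm A B} (τ : t T.⇒ t′) → ⟦ τ ⟧ᴿ ≅ˢ G.F₂ τ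
    ⟦⟧ᴿ-unique (T.id t)          = ≅ˢ-trans (id-≅ (⟦⟧-unique t)) (same (≈.sym G.F₂-id))
    ⟦⟧ᴿ-unique (con σ)           = ≅ˢ-sym (surface≈ σ)
    -- In `𝓢` the right unitor is `ι⁻¹ t` with inverse `ι t`, so `G.F₂ (T.ι t)` is an inverse of a
    -- 2-cell that coherence has already determined.
    ⟦⟧ᴿ-unique (T.ι t)           =
      ⁻¹-≅ (r-invertible _) (F₂-invertible (S.r-invertible t)) (ι⁻¹-unique t)
    ⟦⟧ᴿ-unique (T.ι⁻¹ t)         = ι⁻¹-unique t
    ⟦⟧ᴿ-unique (T.ϱ u)           = ϱ-unique u
    ⟦⟧ᴿ-unique (T.ϱ⁻¹ u)         =
      ⁻¹-≅ (l-invertible _) (F₂-invertible (S.l-invertible u)) (ϱ-unique u)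
    ⟦⟧ᴿ-unique (T.assoc t v u)   = assoc-unique t v u
    ⟦⟧ᴿ-unique (T.assoc⁻¹ t v u) =
      ⁻¹-≅ (a-invertible _ _ _) (F₂-invertible (S.a-invertible t v u)) (assoc-unique t v u)
    ⟦⟧ᴿ-unique (τ′ T.• τ)        =
      ≅ˢ-trans (•-≅ (⟦⟧ᴿ-unique τ′) (⟦⟧ᴿ-unique τ)) (same (≈.sym (G.F₂-• τ′ τ)))
    ⟦⟧ᴿ-unique (τ [ σ ]ᴿ)        =
      ≅ˢ-trans (∗-≅ (⟦⟧ᴿ-unique τ) (⟦⟧ᴿ-unique σ)) (F₂-∗ τ σ)

    ⟦⟧-strictPseudofunctor-unique : ⟦⟧-strictPseudofunctor ≈ˢᴾ G
    ⟦⟧-strictPseudofunctor-unique = record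
      { hom≈ = record
        { node≈    = λ A → sym (node≈ A)
        ; edge≈    = ⟦⟧-unique
        ; surface≈ = ⟦⟧ᴿ-unique
        }
      -- Strictness of `G` reduces this and the next field to comparing identity 2-cells on equal
      -- 1-cells.
      ; ψ≈   = λ X → ≅ˢ-trans (id-≅ (Id-≅ (sym (node≈ X)))) (≅ˢ-sym (G.ψ-strict X))
      ; φ≈   = λ f g →
          ≅ˢ-trans (id-≅ (∘-≅ (⟦⟧-unique f) (⟦⟧-unique g))) (≅ˢ-sym (G.φ-strict f g))
      }

theoremV5 : ∀ {o e s ℓ o′ e′ s′ ℓ′ : Level} (𝒢 : TwoGraph o e s ℓ) (𝓑 : Bicategory o′ e′ s′ ℓ′) (h : TwoGraphHom 𝒢 (Bicategory.twoGraph 𝓑)) →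
    ∃! _≈ˢᴾ_ (λ (h♯ : StrictPseudofunctor (𝓢 𝒢) 𝓑) → StrictPseudofunctor.hom h♯ ∘ᴴ ι 𝒢 ≈ᴴ h)
theoremV5 𝒢 𝓑 h =
    ⟦⟧-strictPseudofunctor
  , ⟦⟧-extends
  , λ {G} extends → Uniqueness.⟦⟧-strictPseudofunctor-unique G extends
  where open Interpretation 𝒢 𝓑 h
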